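{- For every 2NRRA over $\Sigma^{\pm}$, there is an equivalent NRRA over $\Sigma^{\pm}$ (i.e. one accepting the same set of data paths) of exponential size.
   Context: $\Sigma$ is a finite alphabet, $\mathbb{D}$ an infinite set of data values, $\Sigma^{\pm}=\Sigma\cup\{a^-\mid a\in\Sigma\}$. Data paths. A data path over $\Sigma^{\pm}$ is a sequence $\alpha=d_0a_1d_1\dots a_nd_n$ ($n\ge 0$, $d_i\in\mathbb{D}$, $a_i\in\Sigma^{\pm}$). Its positions are $0,\dots,2n$; $d_i$ is at position $2i$ and $a_i$ at position $2i-1$. Position terms over $\Sigma^{\pm}$: $t:=cur\mid suc(t)\mid pred(t)\mid suc_A(t)\mid pred_A(t)$, $\emptyset\ne A\subseteq\Sigma^{\pm}$. For $\alpha$ and an even position $2i$: $cur_\alpha[2i]=2i$; $(suc(cur))_\alpha[2i]=2(i+1)$ if $i<n$, else $\bot$ (undefined); $(pred(cur))_\alpha[2i]=2(i-1)$ if $i>0$, else $\bot$; $(suc_A(cur))_\alpha[2i]=2j$ for the least $j$ with $i<j\le n$, $a_j\in A$, and $\bot$ if none; $(pred_A(cur))_\alpha[2i]=2(j-1)$ for the largest $j$ with $1\le j\le i$, $a_j\in A$, and $\bot$ if none; $(op(t))_\alpha[2i]=(op(cur))_\alpha[t_\alpha[2i]]$ if $t_\alpha[2i]\ne\bot$, else $\bot$. Rigid data constraints: $c:=t_1\sim t_2\mid t_1\not\sim t_2\mid c\vee c\mid c\wedge c$; $(\alpha,2i)\models t_1\sim t_2$ iff $(t_1)_\alpha[2i],(t_2)_\alpha[2i]\ne\bot$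 and the data values of $\alpha$ at these positions are equal; $\not\sim$ is the negation of $\sim$; $\vee,\wedge$ as usual. NRRA over $\Sigma^{\pm}$: $(Q,\delta,I,F)$ with $Q=Q_w\cup Q_d$ finite disjoint, $I\subseteq Q_d$, $F\subseteq Q_w$, $\delta=\delta_w\cup\delta_d$ finite, $\delta_w\subseteq Q_w\times\Sigma^{\pm}\times Q_d$, $\delta_d$ consisting of triples $(q,c,q')$ with $q\in Q_d$, $q'\in Q_w$, $c$ a rigid data constraint. A run over $\alpha$ is $q_0c_0q_1a_1q_2\dots a_nq_{2n}c_nq_{2n+1}$ with $q_0\in I$, $(q_{2i},c_i,q_{2i+1})\in\delta_d$ and $(\alpha,2i)\models c_i$ for $0\le i\le n$, $(q_{2i-1},a_i,q_{2i})\in\delta_w$ for $1\le i\le n$; accepting if $q_{2n+1}\in F$. $\alpha$ is accepted iff there is an accepting run. 2NRRA (two-way NRRA) over $\Sigma^{\pm}$: $(Q,\vdash,\dashv,\delta,I,F)$ with $Q,I,F$ as for NRRAs, $\vdash,\dashv\notin\Sigma^{\pm}$ the left and right endmarkers, $\delta=\delta_w\cup\delta_d$ finite, $\delta_w\subseteq Q\times(\Sigma^{\pm}\cup\{\vdash,\dashv\})\times Q\times\{+1,-1\}$ where transitions on $\vdash$ have direction $+1$ and transitions on $\dashv$ have direction $-1$, and $\delta_d$ a set of tuples $(q,c,q',dir)$ with $q,q'\in Q$, $c$ a rigid data constraint, $dir\in\{+1,-1\}$. For $\alpha=d_0a_1\dots a_nd_n$, the positions of $\vdash\alpha\dashv$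 are $0,\dots,2n+2$ ($\vdash$ at $0$, $\dashv$ at $2n+2$, so position $p$ of $\alpha$ is position $p+1$ of $\vdash\alpha\dashv$). A run over $\alpha$ is $(q_0,i_0)\theta_0(q_1,i_1)\theta_1\dots\theta_{m-1}(q_m,i_m)$ with $q_0\in I$, $i_0=0$, $i_m=2n+2$, and for each $0\le j<m$: if the symbol at position $i_j$ of $\vdash\alpha\dashv$ is $a\in\Sigma^{\pm}\cup\{\vdash,\dashv\}$, then for some $dir$, $(q_j,a,q_{j+1},dir)\in\delta_w$, $\theta_j=a$, $i_{j+1}=i_j+dir$; if it is a data value, then for some $c$ and $dir$, $(q_j,c,q_{j+1},dir)\in\delta_d$, $(\alpha,i_j-1)\models c$, $\theta_j=c$, $i_{j+1}=i_j+dir$. It is accepting if $q_m\in F$; $\alpha$ is accepted iff there is an accepting run. -}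

module Defs where

open import Data.Fin.Base using (Fin; zero; suc; toℕ; fromℕ; inject₁)
open import Data.Fin.Subset using (Subset; _∈_; _∉_; Nonempty; ∣_∣)
open import Data.List.Base using (List; map; length; sum)
open import Data.List.Membership.Propositional using () renaming (_∈_ to _∈ᴸ_)
open import Data.Nat.Base using (ℕ; zero; suc; _+_; _*_; _≤_; _<_)
open import Data.Product using (_×_; _,_; Σ-syntax; ∃-syntax)
open import Data.Sum.Base using (_⊎_; inj₁; inj₂)
open import Data.Vec.Base using (Vec; lookup)
open import Function.Bundles using (_⤖_)
open import Relation.Binary.Construct.Closure.ReflexiveTransitive using (Star)
open import Relation.Binary.PropositionalEquality using (_≡_)
open import Relation.Nullary.Negation using (¬_)

Infinite : Set → Set
Infinite D = ∀ n → ¬ (Fin n ⤖ D)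

-- The alphabet Σ is Fin σ; fwd a is the letter a of Σ and bwd a is a⁻.
data Letter (σ : ℕ) : Set where
  fwd bwd : Fin σ → Letter σ

record LetterSet (σ : ℕ) : Set where
  field
    fwds bwds : Subset σ
    nonempty  : Nonempty fwds ⊎ Nonempty bwds

open LetterSet public

infix 4 _∈±_ _∉±_

_∈±_ _∉±_ : ∀ {σ} → Letter σ → LetterSet σ → Set
fwd a ∈± A = a ∈ fwds A
bwd a ∈± A = a ∈ bwds A
a ∉± A = ¬ (a ∈± A)

-- d₀ a₁ d₁ … aₙ dₙ, where dᵢ = datum i for i : Fin (suc n).  The vector of
-- letters is indexed from 0, so for k : Fin n, letter k is a_{k+1}, which
-- stands between d_k = datum (inject₁ k) and d_{k+1} = datum (suc k).
record DataPath (σ : ℕ) (D : Set) : Set where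
  field
    n       : ℕ
    values  : Vec D (suc n)
    letters : Vec (Letter σ) n

  datum : Fin (suc n) → D
  datum = lookup values

  letter : Fin n → Letter σ
  letter = lookup letters

-- An element i of Index α stands for the even position 2i of α.
Index : ∀ {σ D} → DataPath σ D → Set
Index α = Fin (suc (DataPath.n α))

data Term (σ : ℕ) : Set where
  cur      : Term σ
  suc pred : Term σ → Term σ
  suc⟨_⟩_  : LetterSet σ → Term σ → Term σ
  pred⟨_⟩_ : LetterSet σ → Term σ → Term σ

infix 7 _∼_ _≁_
infixr 6 _∧_
infixr 5 _∨_

data Constraint (σ : ℕ) : Set where
  _∼_ _≁_ : Term σ → Term σ → Constraint σ
  _∨_ _∧_ : Constraint σ → Constraint σ → Constraint σ

module _ {σ : ℕ} {D : Set} (α : DataPath σ D) where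
  open DataPath α

  -- a_{k+1} is the first letter from A after dⱼ (so j < k + 1).
  FirstAfter : LetterSet σ → Index α → Fin n → Set
  FirstAfter A j k =
    toℕ j ≤ toℕ k × letter k ∈± A ×
    (∀ l → toℕ j ≤ toℕ l → toℕ l < toℕ k → letter l ∉± A)

  -- a_{k+1} is the last letter from A before dⱼ (so k + 1 ≤ j).
  LastBefore : LetterSet σ → Index α → Fin n → Set
  LastBefore A j k =
    toℕ k < toℕ j × letter k ∈± A ×
    (∀ l → toℕ k < toℕ l → toℕ l < toℕ j → letter l ∉± A)

  -- Value t i j says that t evaluates to position 2j at position 2i; the
  -- value ⊥ is the absence of such a j.
  data Value : Term σ → Index α → Index α → Set where
    cur    : ∀ {i} → Value cur i i
    suc    : ∀ {t i} (k : Fin n) →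
             Value t i (inject₁ k) → Value (suc t) i (suc k)
    pred   : ∀ {t i} (k : Fin n) →
             Value t i (suc k) → Value (pred t) i (inject₁ k)
    suc⟨⟩  : ∀ {A t i j} (k : Fin n) →
             Value t i j → FirstAfter A j k → Value (suc⟨ A ⟩ t) i (suc k)
    pred⟨⟩ : ∀ {A t i j} (k : Fin n) →
             Value t i j → LastBefore A j k → Value (pred⟨ A ⟩ t) i (inject₁ k)

  SameDatum : Term σ → Term σ → Index α → Set
  SameDatum t₁ t₂ i =
    ∃[ j₁ ] ∃[ j₂ ] (Value t₁ i j₁ × Value t₂ i j₂ × datum j₁ ≡ datum j₂)

infix 4 _,_⊨_

_,_⊨_ : ∀ {σ D} (α : DataPath σ D) → Index α → Constraint σ → Set
α , i ⊨ t₁ ∼ t₂ = SameDatum α t₁ t₂ i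
α , i ⊨ t₁ ≁ t₂ = ¬ SameDatum α t₁ t₂ i
α , i ⊨ c₁ ∨ c₂ = (α , i ⊨ c₁) ⊎ (α , i ⊨ c₂)
α , i ⊨ c₁ ∧ c₂ = (α , i ⊨ c₁) × (α , i ⊨ c₂)

-- The lists of transitions represent finite sets.
record NRRA (σ : ℕ) : Set where
  field
    ∣Qw∣ ∣Qd∣ : ℕ

  Qw : Set
  Qw = Fin ∣Qw∣

  Qd : Set
  Qd = Fin ∣Qd∣

  field
    δw : List (Qw × Letter σ × Qd)
    δd : List (Qd × Constraint σ × Qw)
    I  : Subset ∣Qd∣
    F  : Subset ∣Qw∣

module _ {σ : ℕ} {D : Set} where

  -- The run q₀ c₀ q₁ a₁ q₂ … aₙ q₂ₙ cₙ q₂ₙ₊₁ has q₂ᵢ = qd i and q₂ᵢ₊₁ = qw i.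
  record Run (B : NRRA σ) (α : DataPath σ D) : Set where
    open NRRA B
    open DataPath α
    field
      qd       : Index α → Qd
      c        : Index α → Constraint σ
      qw       : Index α → Qw
      start    : qd zero ∈ I
      dataStep : ∀ i → (qd i , c i , qw i) ∈ᴸ δd
      sat      : ∀ i → α , i ⊨ c i
      wordStep : ∀ k → (qw (inject₁ k) , letter k , qd (suc k)) ∈ᴸ δw

    Accepting : Set
    Accepting = qw (fromℕ n) ∈ F

  Accepts : NRRA σ → DataPath σ D → Set
  Accepts B α = Σ[ r ∈ Run B α ] Run.Accepting r

data Symbol (σ : ℕ) : Set where
  ⊢ ⊣ : Symbol σ
  ltr : Letter σ → Symbol σ

data Dir : Set where
  +1ᵈ -1ᵈ : Dir

record 2NRRA (σ : ℕ) : Set where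
  field
    ∣Qw∣ ∣Qd∣ : ℕ

  Q : Set
  Q = Fin ∣Qw∣ ⊎ Fin ∣Qd∣

  field
    δw : List (Q × Symbol σ × Q × Dir)
    δd : List (Q × Constraint σ × Q × Dir)
    I  : Subset ∣Qd∣
    F  : Subset ∣Qw∣
    ⊢-right : ∀ {q q′ dir} → (q , ⊢ , q′ , dir) ∈ᴸ δw → dir ≡ +1ᵈ
    ⊣-left  : ∀ {q q′ dir} → (q , ⊣ , q′ , dir) ∈ᴸ δw → dir ≡ -1ᵈ

module _ {σ : ℕ} {D : Set} where

  -- The positions of ⊢ α ⊣ carrying ⊢, ⊣ or a letter.
  data SymbolAt (α : DataPath σ D) : ℕ → Symbol σ → Set where
    left  : SymbolAt α 0 ⊢
    inner : ∀ k → SymbolAt α (2 * suc (toℕ k)) (ltr (DataPath.letter α k))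
    right : SymbolAt α (2 * suc (DataPath.n α)) ⊣

-- The position of ⊢ α ⊣ carrying dᵢ.
dataPos : ∀ {m} → Fin m → ℕ
dataPos i = suc (2 * toℕ i)

data Move : Dir → ℕ → ℕ → Set where
  forth : ∀ {p} → Move +1ᵈ p (suc p)
  back  : ∀ {p} → Move -1ᵈ (suc p) p

module _ {σ : ℕ} {D : Set} where

  module _ (A : 2NRRA σ) (α : DataPath σ D) where
    open 2NRRA A

    data Step : Q × ℕ → Q × ℕ → Set where
      onWord : ∀ {q a q′ dir p p′} →
               SymbolAt α p a → (q , a , q′ , dir) ∈ᴸ δw →
               Move dir p p′ → Step (q , p) (q′ , p′)
      onData : ∀ {q c q′ dir p′} (i : Index α) →
               (q , c , q′ , dir) ∈ᴸ δd → α , i ⊨ c →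
               Move dir (dataPos i) p′ → Step (q , dataPos i) (q′ , p′)

  -- An accepting run is a sequence of steps from an initial state on ⊢ to a
  -- final state on ⊣.
  Accepts₂ : 2NRRA σ → DataPath σ D → Set
  Accepts₂ A α =
    ∃[ q ] ∃[ q′ ] (q ∈ I × q′ ∈ F ×
      Star (Step A α) (inj₂ q , 0) (inj₁ q′ , 2 * suc (DataPath.n α)))
    where open 2NRRA A

-- Sizes: all symbols of the constraints are counted, each set of letters
-- contributing its cardinality.
∥_∥ₜ : ∀ {σ} → Term σ → ℕ
∥ cur ∥ₜ        = 1
∥ suc t ∥ₜ      = 1 + ∥ t ∥ₜ
∥ pred t ∥ₜ     = 1 + ∥ t ∥ₜ
∥ suc⟨ A ⟩ t ∥ₜ  = 1 + ∣ fwds A ∣ + ∣ bwds A ∣ + ∥ t ∥ₜ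
∥ pred⟨ A ⟩ t ∥ₜ = 1 + ∣ fwds A ∣ + ∣ bwds A ∣ + ∥ t ∥ₜ

∥_∥c : ∀ {σ} → Constraint σ → ℕ
∥ t₁ ∼ t₂ ∥c = 1 + ∥ t₁ ∥ₜ + ∥ t₂ ∥ₜ
∥ t₁ ≁ t₂ ∥c = 1 + ∥ t₁ ∥ₜ + ∥ t₂ ∥ₜ
∥ c₁ ∨ c₂ ∥c = 1 + ∥ c₁ ∥c + ∥ c₂ ∥c
∥ c₁ ∧ c₂ ∥c = 1 + ∥ c₁ ∥c + ∥ c₂ ∥c

size : ∀ {σ} → NRRA σ → ℕ
size B = ∣Qw∣ + ∣Qd∣ + length δw + sum (map (λ (_ , c , _) → 1 + ∥ c ∥c) δd)
  where open NRRA B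

size₂ : ∀ {σ} → 2NRRA σ → ℕ
size₂ A = ∣Qw∣ + ∣Qd∣ + length δw + sum (map (λ (_ , c , _ , _) → 1 + ∥ c ∥c) δd)
  where open 2NRRA A

{-# OPTIONS --safe #-}

-- Shepherdson's crossing tables.  For a boundary p of ⊢ α ⊣, the table of p is
-- the set of pairs (q , q′) such that A, entering the part left of p in state
-- q, can come back to p in state q′.  The table of p + 1 is computed from that
-- of p and the transitions enabled at p.  B keeps the table together with the
-- state in which an accepting run of A reaches the boundary for the first
-- time.  Which constraints hold at a data value is undecidable in general, so B
-- guesses the set of data transitions that A uses there and checks the
-- conjunction of their constraints: a larger set of satisfied transitions does
-- no harm, and no constraint has to be refuted.
module Submission where

open import Defs
open import Data.Nat.Base using (ℕ; _+_; _*_; _^_; _≤_)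
open import Data.Product using (_×_; ∃-syntax)
open import Function.Bundles using (_⇔_)

open import Data.Bool.Base using (true)
open import Data.Empty using (⊥)
open import Data.Fin.Base using (Fin; zero; suc; toℕ; fromℕ; inject₁; finToFun; funToFin)
open import Data.Fin.Induction using (<-weakInduction)
open import Data.Fin.Properties as Fin
  using (finToFun-funToFin; any?; *↔×; +↔⊎; toℕ-inject₁; toℕ-fromℕ; toℕ<n; toℕ-injective)
open import Data.Fin.Subset using (Subset; _∈_)
open import Data.Fin.Subset.Properties using (_∈?_)
open import Data.List.Base
  using (List; []; _∷_; filter; cartesianProduct; allFin; map; foldr; length; lookup; mapMaybe)
import Data.List.Membership.DecPropositional as DecMembership
open import Data.List.Membership.Propositional using () renaming (_∈_ to _∈ᴸ_)
open import Data.List.Membership.Propositional.Properties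
  using (∈-filter⁺; ∈-filter⁻; ∈-cartesianProduct⁺; ∈-allFin; ∈-map⁺; ∈-map⁻; ∈-lookup)
open import Data.List.Properties
  using (length-++; length-map; length-filter; length-tabulate; length-mapMaybe;
         map-tabulate; tabulate-lookup; map-∘)
open import Data.List.Relation.Unary.Any as Any using (here; there; index)
import Data.List.Relation.Unary.Any.Properties as Any
open import Data.Maybe.Base using (Maybe; just; nothing)
import Data.Maybe.Relation.Unary.Any as Maybe
open import Data.Nat.Base using (zero; suc; _<_; z≤n; s≤s; z<s)
open import Data.Nat.ListAction using (sum)
open import Data.Nat.Properties
open import Data.Nat.Tactic.RingSolver using (solve-∀)
open import Data.Product using (_,_; Σ-syntax; proj₁; proj₂; uncurry)
open import Data.Product.Function.NonDependent.Propositional using (_×-↔_)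
open import Data.Product.Properties using () renaming (≡-dec to ×-≟)
open import Data.Sum.Base using (_⊎_; inj₁; inj₂; [_,_]′)
open import Data.Vec.Base using (tabulate)
open import Data.Vec.Properties using (lookup∘tabulate; []=⇒lookup; lookup⇒[]=)
open import Function.Base using (_∘_)
open import Function.Bundles using (_↔_; mk⇔; Equivalence; Inverse)
open import Function.Properties.Inverse using (↔-sym; ↔-trans; ↔-refl; ↔⇒↣)
open import Relation.Binary.Construct.Closure.ReflexiveTransitive as Star
  using (Star; ε; _◅_; _◅◅_)
open import Relation.Binary.Definitions using (Decidable; DecidableEquality)
open import Relation.Binary.PropositionalEquality
open import Relation.Nullary.Decidable
  using (Dec; yes; no; map′; _×-dec_; _⊎-dec_; does; dec-true; via-injection)
open import Relation.Nullary.Negation using (contradiction)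
import Relation.Unary as U

open Equivalence using (to; from)

-- Finite types, coded subsets and decidable reachability.

module _ {X : Set} {n} (fin : X ↔ Fin n) where
  open Inverse fin using (strictlyInverseʳ) renaming (to to enc; from to dec)

  opaque
    finite-≟ : DecidableEquality X
    finite-≟ = via-injection (↔⇒↣ fin) Fin._≟_

    finite-∃? : {P : X → Set} → U.Decidable P → Dec (∃[ x ] P x)
    finite-∃? {P} P? = map′
      (λ (k , p) → dec k , p)
      (λ (x , p) → enc x , subst P (sym (strictlyInverseʳ x)) p)
      (any? (P? ∘ dec))

-- A number below 2ⁿ codes the set of positions of its binary digits 1.
Code : ℕ → Set
Code n = Fin (2 ^ n)

infix 4 _∈ᶜ_ _∈ᶜ?_

opaque
  _∈ᶜ_ : ∀ {n} → Fin n → Code n → Set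
  k ∈ᶜ u = finToFun u k ≡ suc zero

  _∈ᶜ?_ : ∀ {n} (k : Fin n) (u : Code n) → Dec (k ∈ᶜ u)
  k ∈ᶜ? u = finToFun u k Fin.≟ suc zero

digit : {P : Set} → Dec P → Fin 2
digit (yes _) = suc zero
digit (no  _) = zero

digit-⇔ : {P : Set} (P? : Dec P) → digit P? ≡ suc zero ⇔ P
digit-⇔ (yes p) = mk⇔ (λ _ → p) (λ _ → refl)
digit-⇔ (no ¬p) = mk⇔ (λ ()) (λ p → contradiction p ¬p)

opaque
  unfolding _∈ᶜ_

  code : ∀ {n} {P : Fin n → Set} → U.Decidable P → Code n
  code P? = funToFin (digit ∘ P?)

  ∈-code : ∀ {n} {P : Fin n → Set} (P? : U.Decidable P) k → k ∈ᶜ code P? ⇔ P k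
  ∈-code P? k rewrite finToFun-funToFin (digit ∘ P?) k = digit-⇔ (P? k)

-- A walk along e ∷ es either avoids e or can be cut to use e exactly once.
module _ {X : Set} (_≟_ : DecidableEquality X) where

  Edge : List (X × X) → X → X → Set
  Edge es x y = (x , y) ∈ᴸ es

  Via : X × X → List (X × X) → X → X → Set
  Via (s , t) es x y =
    Star (Edge es) x y ⊎ (Star (Edge es) x s × Star (Edge es) t y)

  via⁺ : ∀ {e es x y} → Via e es x y → Star (Edge (e ∷ es)) x y
  via⁺ (inj₁ xs)        = Star.map there xs
  via⁺ (inj₂ (xs , ys)) = Star.map there xs ◅◅ here refl ◅ Star.map there ys

  via⁻ : ∀ {e es x y} → Star (Edge (e ∷ es)) x y → Via e es x y
  via⁻ ε = inj₁ ε
  -- If the rest of the walk uses the edge again, only what follows that use is kept; the loop back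
  -- to its source is dropped.
  via⁻ (here refl ◅ xs) = inj₂ (ε , [ (λ ys → ys) , proj₂ ]′ (via⁻ xs))
  via⁻ (there x∈ ◅ xs) with via⁻ xs
  ... | inj₁ ys        = inj₁ (x∈ ◅ ys)
  ... | inj₂ (ys , zs) = inj₂ (x∈ ◅ ys , zs)

  edges-star? : ∀ es → Decidable (Star (Edge es))
  edges-star? [] x y =
    map′ (λ { refl → ε }) (λ { ε → refl ; (() ◅ _) }) (x ≟ y)
  edges-star? (e@(s , t) ∷ es) x y = map′ via⁺ via⁻
    (edges-star? es x y ⊎-dec (edges-star? es x s ×-dec edges-star? es t y))

opaque
  -- On a finite type the decidable relation `R` is a finite list of edges, namely the related pairs
  -- among all pairs, so reachability is decided by recursion on that list.
  star? : ∀ {X : Set} {n} → X ↔ Fin n →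
          {R : X → X → Set} → Decidable R → Decidable (Star R)
  star? {X} {n} fin {R} R? x y = map′
    (Star.map λ e → proj₂ (∈-filter⁻ R?′ {xs = cartesianProduct all all} e))
    (Star.map λ r → ∈-filter⁺ R?′ (∈-cartesianProduct⁺ (∈-all _) (∈-all _)) r)
    (edges-star? (finite-≟ fin) (filter R?′ (cartesianProduct all all)) x y)
    where
    open Inverse fin using (strictlyInverseʳ) renaming (to to enc; from to dec)
    R?′ : U.Decidable (uncurry R)
    R?′ (x , y) = R? x y
    all : List X
    all = map dec (allFin n)
    ∈-all : ∀ z → z ∈ᴸ all
    ∈-all z = subst (_∈ᴸ all) (strictlyInverseʳ z) (∈-map⁺ dec (∈-allFin (enc z)))

-- Crossing tables of two-way walks

-- Transitions without their labels.
Jump : Set → Set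
Jump Q = Q × Q × Dir

module Tables {Q : Set} {s} (fin : Q ↔ Fin s) where

  pairs : (Q × Q) ↔ Fin (s * s)
  pairs = ↔-trans (fin ×-↔ fin) (↔-sym *↔×)

  open Inverse pairs using (strictlyInverseʳ) renaming (to to enc; from to dec)

  Table : Set
  Table = Code (s * s)

  opaque
    Entry : Table → Q → Q → Set
    Entry T q q′ = enc (q , q′) ∈ᶜ T

    entry? : ∀ T → Decidable (Entry T)
    entry? T q q′ = enc (q , q′) ∈ᶜ? T

    table : {R : Q → Q → Set} → Decidable R → Table
    table R? = code (λ k → uncurry R? (dec k))

    entry-table : {R : Q → Q → Set} (R? : Decidable R) →
                  ∀ q q′ → Entry (table R?) q q′ ⇔ R q q′
    entry-table {R} R? q q′ =
      subst (λ z → Entry (table R?) q q′ ⇔ uncurry R z) (strictlyInverseʳ (q , q′))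
        (∈-code (λ k → uncurry R? (dec k)) (enc (q , q′)))

  never? : Decidable {A = Q} {B = Q} (λ _ _ → ⊥)
  never? _ _ = no λ ()

  ∅ᵀ : Table
  ∅ᵀ = table never?

  -- With `R` the table of a boundary and `P` the jumps enabled there: one move to the left followed
  -- by an excursion that comes back. Shepherdson's update makes any number of turns and then moves
  -- right, which is `Crossing`.
  Turn : (Q → Q → Set) → (Jump Q → Set) → Q → Q → Set
  Turn R P a b = ∃[ c ] (P (a , c , -1ᵈ) × R c b)

  Crossing : (Q → Q → Set) → (Jump Q → Set) → Q → Q → Set
  Crossing R P q q′ = ∃[ r ] (Star (Turn R P) q r × P (r , q′ , +1ᵈ))

  turn-map : ∀ {R R′ P P′} → (∀ q q′ → R q q′ → R′ q q′) → (∀ t → P t → P′ t) →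
             ∀ {q q′} → Turn R P q q′ → Turn R′ P′ q q′
  turn-map f g (c , p , e) = c , g _ p , f _ _ e

  crossing-map : ∀ {R R′ P P′} → (∀ q q′ → R q q′ → R′ q q′) → (∀ t → P t → P′ t) →
                 ∀ {q q′} → Crossing R P q q′ → Crossing R′ P′ q q′
  crossing-map f g (r , ts , p) = r , Star.map (turn-map f g) ts , g _ p

  module _ (T : Table) {P : Jump Q → Set} (P? : U.Decidable P) where

    turns? : Decidable (Star (Turn (Entry T) P))
    turns? = star? fin λ a b → finite-∃? fin λ c → P? (a , c , -1ᵈ) ×-dec entry? T c b

    crossing? : Decidable (Crossing (Entry T) P)
    crossing? q q′ = finite-∃? fin λ r → turns? q r ×-dec P? (r , q′ , +1ᵈ)

    opaque
      advance : Table
      advance = table crossing?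

      entry-advance : ∀ q q′ → Entry advance q q′ ⇔ Crossing (Entry T) P q q′
      entry-advance = entry-table crossing?

  module Walks (W : ℕ → Jump Q → Set) where

    -- Only the source of a step is bounded. A walk may therefore arrive at `m` but cannot continue
    -- from there, so a walk ending at `m` has its first visit to `m` at its end.
    data Go (m : ℕ) : Q × ℕ → Q × ℕ → Set where
      go : ∀ {q p q′ p′ d} → p < m → W p (q , q′ , d) → Move d p p′ →
           Go m (q , p) (q′ , p′)

    Walk : ℕ → Q × ℕ → Q × ℕ → Set
    Walk m = Star (Go m)

    -- Excursions to the left of m that come back to m.
    data Return : ℕ → Q → Q → Set where
      return : ∀ {p c b} → Walk (suc p) (c , p) (b , suc p) → Return (suc p) c b

    walk-suc : ∀ {m x y} → Walk m x y → Walk (suc m) x y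
    walk-suc = Star.map λ { (go p<m w mv) → go (m<n⇒m<1+n p<m) w mv }

    stuck : ∀ {m q p y} → m ≤ p → Walk m (q , p) y → y ≡ (q , p)
    stuck m≤p ε = refl
    stuck m≤p (go p<m _ _ ◅ _) = contradiction p<m (≤⇒≯ m≤p)

    turn-walk : ∀ {m q q′} → Turn (Return m) (W m) q q′ → Walk (suc m) (q , m) (q′ , m)
    turn-walk {suc p} (c , w , return ws) = go (n<1+n _) w back ◅ walk-suc ws

    turns-walk : ∀ {m q q′} → Star (Turn (Return m) (W m)) q q′ →
                 Walk (suc m) (q , m) (q′ , m)
    turns-walk ε        = ε
    turns-walk (t ◅ ts) = turn-walk t ◅◅ turns-walk ts

    crossing⇒return : ∀ {m q q′} → Crossing (Return m) (W m) q q′ → Return (suc m) q q′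
    crossing⇒return (r , ts , w) = return (turns-walk ts ◅◅ go (n<1+n _) w forth ◅ ε)

    -- Cut the walk at its visits to `m`: the piece before the first visit never leaves from `m`,
    -- and each later piece starts with a move to the left and is an excursion.
    walk⇒turns : ∀ {m q q′ x} → x ≤ m → Walk (suc m) (q , x) (q′ , m) →
                 ∃[ r ] (Walk m (q , x) (r , m) × Star (Turn (Return m) (W m)) r q′)
    walk⇒turns _ ε = _ , ε , ε
    walk⇒turns x≤m (go {p = x} _ w mv ◅ ws) with m≤n⇒m<n∨m≡n x≤m
    walk⇒turns x≤m (go _ w forth ◅ ws) | inj₁ x<m
      with r , us , ts ← walk⇒turns x<m ws = r , go x<m w forth ◅ us , ts
    walk⇒turns x≤m (go _ w back ◅ ws) | inj₁ x<m
      with r , us , ts ← walk⇒turns (<⇒≤ (<-trans (n<1+n _) x<m)) ws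
      = r , go x<m w back ◅ us , ts
    -- A forward move from `m` lands on `suc m`, where the walk is stuck, so it could not end at
    -- `m`.
    walk⇒turns x≤m (go _ w forth ◅ ws) | inj₂ refl with stuck ≤-refl ws
    ... | ()
    walk⇒turns x≤m (go _ w back ◅ ws) | inj₂ refl
      with r , us , ts ← walk⇒turns (n≤1+n _) ws
      = _ , ε , (_ , w , return us) ◅ ts

    -- The bound forbids leaving `suc m`, so that position is entered only once, at the end, and
    -- only by a forward move from `m`.
    last-step : ∀ {m q q′ x} → x ≤ m → Walk (suc m) (q , x) (q′ , suc m) →
                ∃[ r ] (Walk (suc m) (q , x) (r , m) × W m (r , q′ , +1ᵈ))
    last-step 1+m≤m ε = contradiction 1+m≤m 1+n≰n
    last-step x≤m (go x<1+m w back ◅ ws)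
      with r , us , v ← last-step (<⇒≤ x≤m) ws = r , go x<1+m w back ◅ us , v
    last-step x≤m (go x<1+m w forth ◅ ws) with m≤n⇒m<n∨m≡n x≤m
    ... | inj₁ x<m with r , us , v ← last-step x<m ws = r , go x<1+m w forth ◅ us , v
    ... | inj₂ refl with refl ← stuck ≤-refl ws = _ , ε , w

    -- The first visit to `m` separates the two factors; the turns made at `m` and the final forward
    -- move form the crossing.
    split-walk : ∀ {m q q′ x} → x ≤ m → Walk (suc m) (q , x) (q′ , suc m) →
                 ∃[ r ] (Walk m (q , x) (r , m) × Crossing (Return m) (W m) r q′)
    split-walk x≤m ws
      with u , us , w ← last-step x≤m ws
      with r , vs , ts ← walk⇒turns x≤m us = r , vs , u , ts , w

    -- The excursion starts on `m` itself, so its part before the first visit to `m` is empty.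
    return⇒crossing : ∀ {m q q′} → Return (suc m) q q′ → Crossing (Return m) (W m) q q′
    return⇒crossing (return ws) with r , us , c ← split-walk ≤-refl ws
      with refl ← stuck ≤-refl us = c

    return-walk : ∀ {m x q q′} → Walk m x (q , m) → Return (suc m) q q′ →
                  Walk (suc m) x (q′ , suc m)
    return-walk us (return ws) = walk-suc us ◅◅ ws

    Exact : ℕ → Table → Set
    Exact m T = ∀ q q′ → Entry T q q′ ⇔ Return m q q′

    exact-zero : Exact 0 ∅ᵀ
    exact-zero q q′ = mk⇔ (λ e → contradiction (to (entry-table never? q q′) e) λ ()) (λ ())

    exact-advance : ∀ {m T P} (P? : U.Decidable P) → (∀ t → P t ⇔ W m t) →
                    Exact m T → Exact (suc m) (advance T P?)
    exact-advance {m} {T} P? P⇔W ex q q′ = mk⇔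
      (crossing⇒return ∘ crossing-map (λ a b → to (ex a b)) (λ t → to (P⇔W t))
        ∘ to (entry-advance T P? q q′))
      (from (entry-advance T P? q q′) ∘ crossing-map (λ a b → from (ex a b)) (λ t → from (P⇔W t))
        ∘ return⇒crossing)

-- Symbols, conjunctions of constraints and finite sequences.

infix 4 _≟ᵈ_ _≟ˡ_ _≟ˢ_

_≟ᵈ_ : DecidableEquality Dir
+1ᵈ ≟ᵈ +1ᵈ = yes refl
+1ᵈ ≟ᵈ -1ᵈ = no λ ()
-1ᵈ ≟ᵈ +1ᵈ = no λ ()
-1ᵈ ≟ᵈ -1ᵈ = yes refl

_≟ˡ_ : ∀ {σ} → DecidableEquality (Letter σ)
fwd a ≟ˡ fwd b = map′ (cong fwd) (λ { refl → refl }) (a Fin.≟ b)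
fwd a ≟ˡ bwd b = no λ ()
bwd a ≟ˡ fwd b = no λ ()
bwd a ≟ˡ bwd b = map′ (cong bwd) (λ { refl → refl }) (a Fin.≟ b)

_≟ˢ_ : ∀ {σ} → DecidableEquality (Symbol σ)
⊢     ≟ˢ ⊢     = yes refl
⊢     ≟ˢ ⊣     = no λ ()
⊢     ≟ˢ ltr b = no λ ()
⊣     ≟ˢ ⊢     = no λ ()
⊣     ≟ˢ ⊣     = yes refl
⊣     ≟ˢ ltr b = no λ ()
ltr a ≟ˢ ⊢     = no λ ()
ltr a ≟ˢ ⊣     = no λ ()
ltr a ≟ˢ ltr b = map′ (cong ltr) (λ { refl → refl }) (a ≟ˡ b)

toLetter : ∀ {σ} → Symbol σ → Maybe (Letter σ)
toLetter ⊢       = nothing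
toLetter ⊣       = nothing
toLetter (ltr a) = just a

subset : ∀ {n} {P : Fin n → Set} → U.Decidable P → Subset n
subset P? = tabulate (does ∘ P?)

∈-subset : ∀ {n} {P : Fin n → Set} (P? : U.Decidable P) k → k ∈ subset P? ⇔ P k
∈-subset P? k = mk⇔
  (λ k∈ → does-true (P? k) (trans (sym (lookup∘tabulate (does ∘ P?) k)) ([]=⇒lookup k∈)))
  (λ p → lookup⇒[]= k _ (trans (lookup∘tabulate (does ∘ P?) k) (dec-true (P? k) p)))
  where
  does-true : ∀ {P : Set} (P? : Dec P) → does P? ≡ true → P
  does-true (yes p) _ = p

-- Constraints have no constant for truth; `cur ∼ cur` serves as one, since `cur` is defined
-- everywhere.
conj : ∀ {σ} → List (Constraint σ) → Constraint σ
conj = foldr _∧_ (cur ∼ cur)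

module _ {σ D} (α : DataPath σ D) (i : Index α) where

  conj⁺ : ∀ cs → (∀ {c} → c ∈ᴸ cs → α , i ⊨ c) → α , i ⊨ conj cs
  conj⁺ []       _ = i , i , cur , cur , refl
  conj⁺ (c ∷ cs) f = f (here refl) , conj⁺ cs (f ∘ there)

  conj⁻ : ∀ {cs c} → α , i ⊨ conj cs → c ∈ᴸ cs → α , i ⊨ c
  conj⁻ (s , _) (here refl) = s
  conj⁻ (_ , s) (there c∈)  = conj⁻ s c∈

iterate : ∀ {X : Set} {n} → (Fin n → X → X) → X → Fin (suc n) → X
iterate g x zero = x
iterate {n = suc n} g x (suc k) = iterate (g ∘ suc) (g zero x) k

iterate-suc : ∀ {X : Set} {n} (g : Fin n → X → X) x k →
              iterate g x (suc k) ≡ g k (iterate g x (inject₁ k))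
iterate-suc g x zero    = refl
iterate-suc g x (suc k) = iterate-suc (g ∘ suc) (g zero x) k

-- Each witness is chosen from the one after it, starting at the last index. This collects states of
-- first visits, which are found by cutting a walk from its right end.
descend : ∀ {X : Set} {n} (P : Fin (suc n) → X → Set) (R : Fin n → X → X → Set) →
          (∀ k {y} → P (suc k) y → ∃[ x ] (P (inject₁ k) x × R k x y)) →
          ∀ {y} → P (fromℕ n) y →
          Σ[ f ∈ (Fin (suc n) → X) ] (f (fromℕ n) ≡ y × (∀ i → P i (f i)) ×
                  (∀ k → R k (f (inject₁ k)) (f (suc k))))
descend {n = zero} P R _ {y} p = (λ _ → y) , refl , (λ { zero → p }) , λ ()
descend {X} {suc n} P R prev p
  with f , last , Pf , Rf ← descend (P ∘ suc) (R ∘ suc) (prev ∘ suc) p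
  with x , Px , Rx ← prev zero (Pf zero)
  = f′ , last , (λ { zero → Px ; (suc i) → Pf i }) , λ { zero → Rx ; (suc k) → Rf k }
  where
  f′ : Fin (suc (suc n)) → X
  f′ zero    = x
  f′ (suc i) = f i

-- The one-way automaton

module Construction {σ : ℕ} (A : 2NRRA σ) where
  open 2NRRA A

  s m : ℕ
  s = ∣Qw∣ + ∣Qd∣
  m = length δd

  opaque
    states : Q ↔ Fin s
    states = ↔-sym +↔⊎

  open Tables states

  _≟ᵠ_ : DecidableEquality Q
  _≟ᵠ_ = finite-≟ states

  OnSymbol : Symbol σ → Jump Q → Set
  OnSymbol a (q , q′ , d) = (q , a , q′ , d) ∈ᴸ δw

  onSymbol? : ∀ a → U.Decidable (OnSymbol a)
  onSymbol? a (q , q′ , d) = (q , a , q′ , d) ∈ᴸ? δw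
    where open DecMembership (×-≟ _≟ᵠ_ (×-≟ _≟ˢ_ (×-≟ _≟ᵠ_ _≟ᵈ_))) renaming (_∈?_ to _∈ᴸ?_)

  jump : Fin m → Jump Q
  jump j = let q , _ , q′ , d = lookup δd j in q , q′ , d

  guard : Fin m → Constraint σ
  guard j = proj₁ (proj₂ (lookup δd j))

  -- A guess names data transitions by their places in `δd`, so that there are `2 ^ m` guesses and
  -- each place has its own constraint.
  OnGuess : Code m → Jump Q → Set
  OnGuess S t = ∃[ j ] (j ∈ᶜ S × jump j ≡ t)

  onGuess? : ∀ S → U.Decidable (OnGuess S)
  onGuess? S t = any? λ j → j ∈ᶜ? S ×-dec ×-≟ _≟ᵠ_ (×-≟ _≟ᵠ_ _≟ᵈ_) (jump j) t

  guards : Code m → Constraint σ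
  guards S = conj (map guard (filter (_∈ᶜ? S) (allFin m)))

  module _ {D} {α : DataPath σ D} {i : Index α} where

    guards⁺ : ∀ {S} → (∀ {j : Fin m} → j ∈ᶜ S → α , i ⊨ guard j) → α , i ⊨ guards S
    guards⁺ {S} f = conj⁺ α i _ λ c∈ → case (∈-map⁻ guard c∈)
      where
      case : ∀ {c} → ∃[ j ] (j ∈ᴸ filter (_∈ᶜ? S) (allFin m) × c ≡ guard j) → α , i ⊨ c
      case (j , j∈ , refl) = f (proj₂ (∈-filter⁻ (_∈ᶜ? S) {xs = allFin m} j∈))

    guards⁻ : ∀ {S j} → α , i ⊨ guards S → j ∈ᶜ S → α , i ⊨ guard j
    guards⁻ {S} sat j∈ =
      conj⁻ α i sat (∈-map⁺ guard (∈-filter⁺ (_∈ᶜ? S) (∈-allFin _) j∈))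

  State : Set
  State = Table × Q

  M : ℕ
  M = 2 ^ (s * s) * s

  opaque
    codes : State ↔ Fin M
    codes = ↔-trans (↔-refl ×-↔ states) (↔-sym *↔×)

  open Inverse codes using (strictlyInverseʳ) renaming (to to enc; from to dec)

  -- The table is updated deterministically; only the state is chosen. The new table is consulted,
  -- because it is the one that describes excursions from the current position to the next.
  Next : {P : Jump Q → Set} → U.Decidable P → State → State → Set
  Next P? (T , q) (T′ , q′) = T′ ≡ advance T P? × Entry T′ q q′

  next? : {P : Jump Q → Set} (P? : U.Decidable P) → Decidable (Next P?)
  next? P? (T , q) (T′ , q′) = T′ Fin.≟ advance T P? ×-dec entry? T′ q q′

  -- The initial table is that of the boundary just after `⊢`. An accepting run may turn back at `⊣`
  -- several times before it ends there, so `Final` asks for a sequence of turns and no forward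
  -- move.
  Initial Final : State → Set
  Initial (T , q) = T ≡ advance ∅ᵀ (onSymbol? ⊢) × ∃[ q₀ ] (q₀ ∈ I × Entry T (inj₂ q₀) q)
  Final (T , q) = ∃[ q′ ] (q′ ∈ F × Star (Turn (Entry T) (OnSymbol ⊣)) q (inj₁ q′))

  initial? : U.Decidable Initial
  initial? (T , q) = T Fin.≟ advance ∅ᵀ (onSymbol? ⊢) ×-dec
                     any? λ q₀ → q₀ ∈? I ×-dec entry? T (inj₂ q₀) q

  final? : U.Decidable Final
  final? (T , q) = any? λ q′ → q′ ∈? F ×-dec turns? T (onSymbol? ⊣) q (inj₁ q′)

  -- The size of `A` does not bound `σ`, so `B` reads only letters that occur in `δw`, of which
  -- there are at most `length δw`.
  readLetters : List (Letter σ)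
  readLetters = mapMaybe (λ t → toLetter (proj₁ (proj₂ t))) δw

  ∈-readLetters : ∀ {q a q′ d} → (q , ltr a , q′ , d) ∈ᴸ δw → a ∈ᴸ readLetters
  ∈-readLetters t∈ = Any.mapMaybe⁺ _ δw (Any.map⁺ (Any.map (λ { refl → Maybe.just refl }) t∈))

  triples : {X : Set} → List X → List (Fin M × X × Fin M)
  triples xs = cartesianProduct (allFin M) (cartesianProduct xs (allFin M))

  ∈-triples : {X : Set} {xs : List X} → ∀ {x y z} → y ∈ᴸ xs → (x , y , z) ∈ᴸ triples xs
  ∈-triples y∈ = ∈-cartesianProduct⁺ (∈-allFin _) (∈-cartesianProduct⁺ y∈ (∈-allFin _))

  WordStep : Fin M × Letter σ × Fin M → Set
  WordStep (x , a , y) = Next (onSymbol? (ltr a)) (dec x) (dec y)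

  DataStep : Fin M × Code m × Fin M → Set
  DataStep (x , S , y) = Next (onGuess? S) (dec x) (dec y)

  word? : U.Decidable WordStep
  word? (x , a , y) = next? (onSymbol? (ltr a)) (dec x) (dec y)

  datum? : U.Decidable DataStep
  datum? (x , S , y) = next? (onGuess? S) (dec x) (dec y)

  guarded : Fin M × Code m × Fin M → Fin M × Constraint σ × Fin M
  guarded (x , S , y) = x , guards S , y

  B : NRRA σ
  B = record
    { ∣Qw∣ = M
    ; ∣Qd∣ = M
    ; δw   = filter word? (triples readLetters)
    ; δd   = map guarded (filter datum? (triples (allFin (2 ^ m))))
    ; I    = subset (initial? ∘ dec)
    ; F    = subset (final? ∘ dec)
    }

  -- Correctness of the construction on a fixed data path.

  module _ {D : Set} (α : DataPath σ D) where
    open DataPath α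

    Guess : Set
    Guess = Index α → Code m

    Satisfied : Guess → Set
    Satisfied S = ∀ i {j : Fin m} → j ∈ᶜ S i → α , i ⊨ guard j

    end : ℕ
    end = 2 * suc n

    -- At a data value exactly the guessed transitions are enabled, whether or not their constraints
    -- hold; the latter is the separate condition `Satisfied`.
    data Enabled (S : Guess) : ℕ → Jump Q → Set where
      onWord : ∀ {p a t} → SymbolAt α p a → OnSymbol a t → Enabled S p t
      onData : ∀ {t} i → OnGuess (S i) t → Enabled S (dataPos i) t

    symbolAt-even : ∀ {p a} → SymbolAt α p a → ∃[ k ] p ≡ 2 * k
    symbolAt-even left      = 0 , refl
    symbolAt-even (inner k) = suc (toℕ k) , refl
    symbolAt-even right     = suc n , refl

    ¬symbolAt-dataPos : ∀ {p a m} {i : Fin m} → SymbolAt α p a → p ≢ dataPos i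
    ¬symbolAt-dataPos {i = i} at eq with k , refl ← symbolAt-even at = even≢odd k (toℕ i) eq

    inner≢right : ∀ (k : Fin n) → 2 * suc (toℕ k) ≢ 2 * suc n
    inner≢right k eq =
      <⇒≢ (toℕ<n k) (suc-injective (*-cancelˡ-≡ (suc (toℕ k)) (suc n) 2 eq))

    symbolAt-functional : ∀ {p p′ a b} → SymbolAt α p a → SymbolAt α p′ b → p ≡ p′ → a ≡ b
    symbolAt-functional left      left       _  = refl
    symbolAt-functional left      (inner _)  ()
    symbolAt-functional left      right      ()
    symbolAt-functional (inner _) left       ()
    symbolAt-functional (inner k) (inner k′) eq
      with refl ← toℕ-injective {i = k} {k′}
                    (suc-injective (*-cancelˡ-≡ (suc (toℕ k)) (suc (toℕ k′)) 2 eq)) = refl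
    symbolAt-functional (inner k) right      eq = contradiction eq (inner≢right k)
    symbolAt-functional right     left       ()
    symbolAt-functional right     (inner k)  eq = contradiction (sym eq) (inner≢right k)
    symbolAt-functional right     right      _  = refl

    module _ {S : Guess} where

      enabled-word : ∀ {p a} → SymbolAt α p a → ∀ t → OnSymbol a t ⇔ Enabled S p t
      enabled-word {p} {a} at t = mk⇔ (onWord at) (λ e → inv e refl)
        where
        inv : ∀ {p′} → Enabled S p′ t → p′ ≡ p → OnSymbol a t
        inv (onWord at′ t∈) eq with refl ← symbolAt-functional at′ at eq = t∈
        inv (onData i _) eq = contradiction (sym eq) (¬symbolAt-dataPos {i = i} at)

      enabled-data : ∀ i t → OnGuess (S i) t ⇔ Enabled S (dataPos i) t
      enabled-data i t = mk⇔ (onData i) (λ e → inv e refl)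
        where
        inv : ∀ {p} → Enabled S p t → p ≡ dataPos i → OnGuess (S i) t
        inv (onWord at _) eq = contradiction eq (¬symbolAt-dataPos {i = i} at)
        inv (onData i′ g) eq
          with refl ← toℕ-injective {i = i′} {i}
                        (*-cancelˡ-≡ (toℕ i′) (toℕ i) 2 (suc-injective eq)) = g

    wordPos : ∀ (k : Fin n) → suc (dataPos (inject₁ k)) ≡ 2 * suc (toℕ k)
    wordPos k = trans (cong (λ x → suc (suc (2 * x))) (toℕ-inject₁ k)) (sym (*-suc 2 (toℕ k)))

    lastPos : suc (dataPos (fromℕ n)) ≡ end
    lastPos = trans (cong (λ x → suc (suc (2 * x))) (toℕ-fromℕ n)) (sym (*-suc 2 n))

    enabled-letter : ∀ {S} k t →
      OnSymbol (ltr (letter k)) t ⇔ Enabled S (suc (dataPos (inject₁ k))) t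
    enabled-letter {S} k t =
      subst (λ p → OnSymbol (ltr (letter k)) t ⇔ Enabled S p t) (sym (wordPos k))
        (enabled-word (inner k) t)

    enabled-last : ∀ {S} t → OnSymbol ⊣ t ⇔ Enabled S (suc (dataPos (fromℕ n))) t
    enabled-last {S} t = subst (λ p → OnSymbol ⊣ t ⇔ Enabled S p t) (sym lastPos)
        (enabled-word right t)

    -- An accepting run of `B` with its states decoded and its constraints replaced by the guesses
    -- behind them.
    record Trace (S : Guess) : Set where
      field
        xd xw    : Index α → State
        initial  : Initial (xd zero)
        dataNext : ∀ i → Next (onGuess? (S i)) (xd i) (xw i)
        wordNext : ∀ k → Next (onSymbol? (ltr (letter k))) (xw (inject₁ k)) (xd (suc k))
        final    : Final (xw (fromℕ n))

    trace⇒accepts : ∀ {S} → Satisfied S → Trace S → Accepts B α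
    trace⇒accepts {S} sat tr = record
      { qd = enc ∘ xd ; c = guards ∘ S ; qw = enc ∘ xw
      ; start = from (∈-subset (initial? ∘ dec) _) (dec-enc Initial initial)
      ; dataStep = λ i → ∈-map⁺ guarded (∈-filter⁺ datum? (∈-triples (∈-allFin (S i)))
          (dec-enc₂ (Next (onGuess? (S i))) (dataNext i)))
      ; sat = λ i → guards⁺ (sat i)
      ; wordStep = λ k → ∈-filter⁺ word? (∈-triples (letter∈ (wordNext k)))
          (dec-enc₂ (Next (onSymbol? (ltr (letter k)))) (wordNext k))
      } , from (∈-subset (final? ∘ dec) _) (dec-enc Final final)
      where
      open Trace tr
      dec-enc : ∀ (P : State → Set) {x} → P x → P (dec (enc x))
      dec-enc P {x} = subst P (sym (strictlyInverseʳ x))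
      dec-enc₂ : ∀ (R : State → State → Set) {x y} → R x y → R (dec (enc x)) (dec (enc y))
      dec-enc₂ R {x} {y} = subst₂ R (sym (strictlyInverseʳ x)) (sym (strictlyInverseʳ y))
      -- The entry used by the step is a crossing, and a crossing ends with a forward transition of
      -- `A` on the letter.
      letter∈ : ∀ {x y a} → Next (onSymbol? (ltr a)) x y → a ∈ᴸ readLetters
      letter∈ {T , q} {_ , q′} {a} (refl , e)
        with _ , _ , t∈ ← to (entry-advance T (onSymbol? (ltr a)) q q′) e = ∈-readLetters t∈

    accepts⇒trace : Accepts B α → ∃[ S ] (Satisfied S × Trace S)
    accepts⇒trace (r , acc) = (λ i → proj₁ (guess i)) ,
      (λ i → guards⁻ (subst (α , i ⊨_) (proj₁ (proj₂ (guess i))) (sat i))) ,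
      record
        { xd = dec ∘ qd ; xw = dec ∘ qw
        ; initial = to (∈-subset (initial? ∘ dec) _) start
        ; dataNext = λ i → proj₂ (proj₂ (guess i))
        ; wordNext = λ k → proj₂ (∈-filter⁻ word? {xs = triples readLetters} (wordStep k))
        ; final = to (∈-subset (final? ∘ dec) _) acc
        }
      where
      open Run r
      -- Different guesses may yield the same conjunction, so a transition of `B` gives back only
      -- some guess with that constraint.
      transition⁻ : ∀ {x c y} → (x , c , y) ∈ᴸ NRRA.δd B →
                    ∃[ S ] (c ≡ guards S × Next (onGuess? S) (dec x) (dec y))
      transition⁻ t with _ , t∈ , refl ← ∈-map⁻ guarded t
        = _ , refl , proj₂ (∈-filter⁻ datum? {xs = triples (allFin (2 ^ m))} t∈)
      guess = λ i → transition⁻ (dataStep i)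

    -- The bound `suc end` lets steps start on `⊣` as well.
    AcceptingWalk : Guess → Set
    AcceptingWalk S = ∃[ q ] ∃[ q′ ] (q ∈ I × q′ ∈ F ×
      Walks.Walk (Enabled S) (suc end) (inj₂ q , 0) (inj₁ q′ , end))

    module _ {S : Guess} where
      open Walks (Enabled S)

      shift : ∀ {p p′ x q} → p ≡ p′ → Walk p x (q , p) → Walk p′ x (q , p′)
      shift refl ws = ws

      -- Stated for any tables obeying the update equations, since it is applied both to the tables
      -- of a given trace and to those computed from left to right.
      module Tabulation (Td Tw : Index α → Table)
        (Td-zero : Td zero ≡ advance ∅ᵀ (onSymbol? ⊢))
        (Tw-next : ∀ i → Tw i ≡ advance (Td i) (onGuess? (S i)))
        (Td-suc  : ∀ k → Td (suc k) ≡ advance (Tw (inject₁ k)) (onSymbol? (ltr (letter k))))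
        where

        exact-word : ∀ {i} → Exact (dataPos i) (Td i) → Exact (suc (dataPos i)) (Tw i)
        exact-word {i} ex rewrite Tw-next i = exact-advance (onGuess? (S i)) (enabled-data i) ex

        Td-exact : ∀ i → Exact (dataPos i) (Td i)
        Td-exact = <-weakInduction _
          (subst (Exact 1) (sym Td-zero)
            (exact-advance (onSymbol? ⊢) (enabled-word left) exact-zero))
          (λ k ex → subst₂ Exact (cong suc (wordPos k)) (sym (Td-suc k))
            (exact-advance (onSymbol? (ltr (letter k))) (enabled-letter k) (exact-word ex)))

        Tw-exact : ∀ i → Exact (suc (dataPos i)) (Tw i)
        Tw-exact i = exact-word (Td-exact i)

        Td-exact-suc : ∀ k → Exact (suc (suc (dataPos (inject₁ k)))) (Td (suc k))
        Td-exact-suc k =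
          subst (λ p → Exact (suc p) (Td (suc k))) (sym (wordPos k)) (Td-exact (suc k))

        last-turns : ∀ {q q′} →
          Star (Turn (Entry (Tw (fromℕ n))) (OnSymbol ⊣)) q q′ ⇔
          Star (Turn (Return end) (Enabled S end)) q q′
        last-turns {q} {q′} = subst (λ p → Star (Turn (Entry (Tw (fromℕ n))) (OnSymbol ⊣)) q q′ ⇔
                           Star (Turn (Return p) (Enabled S p)) q q′) lastPos
          (mk⇔ (Star.map (turn-map (λ a b → to (Tw-exact _ a b)) (λ t → to (enabled-last {S} t))))
               (Star.map (turn-map (λ a b → from (Tw-exact _ a b)) (λ t → from (enabled-last {S} t)))))

      -- By exactness each entry used in the trace is an excursion to the next position; glued
      -- together they lead to `⊣`, and the turns of `Final` finish the walk there.
      trace⇒walk : Trace S → AcceptingWalk S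
      trace⇒walk tr =
        let f , f∈F , ts = final in
        q₀ , f , proj₁ (proj₂ (proj₂ initial)) , f∈F ,
          (walk-suc (shift lastPos (walk-word (walk-data (fromℕ n))))
            ◅◅ turns-walk (to last-turns ts))
        where
        open Trace tr
        q₀ = proj₁ (proj₂ initial)
        open Tabulation (proj₁ ∘ xd) (proj₁ ∘ xw)
          (proj₁ initial) (proj₁ ∘ dataNext) (proj₁ ∘ wordNext)

        walk-word : ∀ {i} → Walk (dataPos i) (inj₂ q₀ , 0) (proj₂ (xd i) , dataPos i) →
                    Walk (suc (dataPos i)) (inj₂ q₀ , 0) (proj₂ (xw i) , suc (dataPos i))
        walk-word {i} ws = return-walk ws (to (Tw-exact i _ _) (proj₂ (dataNext i)))

        walk-data : ∀ i → Walk (dataPos i) (inj₂ q₀ , 0) (proj₂ (xd i) , dataPos i)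
        walk-data = <-weakInduction _
          (return-walk ε (to (Td-exact zero _ _) (proj₂ (proj₂ (proj₂ initial)))))
          (λ k ws → shift (cong suc (wordPos k))
            (return-walk (walk-word {inject₁ k} ws)
              (to (Td-exact-suc k _ _) (proj₂ (wordNext k)))))

      first : Table
      first = advance ∅ᵀ (onSymbol? ⊢)

      next : Fin n → Table → Table
      next k T = advance (advance T (onGuess? (S (inject₁ k)))) (onSymbol? (ltr (letter k)))

      Td Tw : Index α → Table
      Td   = iterate next first
      Tw i = advance (Td i) (onGuess? (S i))

      open Tabulation Td Tw refl (λ _ → refl) (iterate-suc next first)

      -- The pair holds the states of the first visits to `dᵢ` and to the position right after it.
      Through : Fin ∣Qd∣ → Index α → Q × Q → Set
      Through q₀ i (q , r) =
        Walk (dataPos i) (inj₂ q₀ , 0) (q , dataPos i) × Entry (Tw i) q r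

      Joined : Fin n → Q × Q → Q × Q → Set
      Joined k (_ , r) (q , _) = Entry (Td (suc k)) r q

      before : ∀ q₀ i {r} → Walk (suc (dataPos i)) (inj₂ q₀ , 0) (r , suc (dataPos i)) →
               ∃[ q ] Through q₀ i (q , r)
      before q₀ i us with q , vs , c ← split-walk z≤n us
        = q , vs , from (Tw-exact i _ _) (crossing⇒return c)

      previous : ∀ q₀ k {y} → Through q₀ (suc k) y →
                 ∃[ x ] (Through q₀ (inject₁ k) x × Joined k x y)
      previous q₀ k {q′ , _} (us , _)
        with r , vs , c ← split-walk z≤n
               (shift (cong suc (sym (wordPos k))) us)
        with q , Pq ← before q₀ (inject₁ k) vs
        = (q , r) , Pq , from (Td-exact-suc k _ _) (crossing⇒return c)

      -- The turns at `⊣` are split off first; the remaining walk is then cut at the first visits to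
      -- the positions, from right to left.
      walk⇒trace : AcceptingWalk S → Trace S
      walk⇒trace (q₀ , f , q₀∈I , f∈F , ws) =
        let r , us , ts       = walk⇒turns z≤n ws
            q , Pq            = before q₀ (fromℕ n) (shift (sym lastPos) us)
            g , last , Pg , Rg = descend (Through q₀) Joined (previous q₀) Pq
        in record
          { xd       = λ i → Td i , proj₁ (g i)
          ; xw       = λ i → Tw i , proj₂ (g i)
          -- `dataPos zero` is 1, so the walk up to the first data value is itself an excursion
          -- starting on `⊢`.
          ; initial  = refl , q₀ , q₀∈I , from (Td-exact zero _ _) (return (proj₁ (Pg zero)))
          ; dataNext = λ i → refl , proj₂ (Pg i)
          ; wordNext = λ k → iterate-suc next first k , Rg k
          ; final    = f , f∈F , from last-turns
              (subst (λ z → Star (Turn (Return end) (Enabled S end)) z (inj₁ f))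
                (sym (cong proj₂ last)) ts)
          }

      -- Steps of `A` carry no bound; it comes for free because only positions up to that of `⊣`
      -- have transitions.
      enabled-bound : ∀ {p t} → Enabled S p t → p < suc end
      enabled-bound (onWord left _) = z<s
      enabled-bound (onWord (inner k) _) = s≤s (*-monoʳ-≤ 2 (<⇒≤ (s≤s (toℕ<n k))))
      enabled-bound (onWord right _) = n<1+n _
      enabled-bound (onData i _) = s≤s (≤-trans (n≤1+n _)
        (≤-trans (≤-reflexive (sym (*-suc 2 (toℕ i)))) (*-monoʳ-≤ 2 (toℕ<n i))))

    walk⇒accepts₂ : ∀ {S} → Satisfied S → AcceptingWalk S → Accepts₂ A α
    walk⇒accepts₂ {S} sat (q , q′ , q∈I , q′∈F , ws) = q , q′ , q∈I , q′∈F , Star.map step ws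
      where
      step : ∀ {x y} → Walks.Go (Enabled S) (suc end) x y → Step A α x y
      step (Walks.go _ (onWord at t∈) mv)           = onWord at t∈ mv
      step (Walks.go _ (onData i (j , j∈S , refl)) mv) = onData i (∈-lookup j) (sat i j∈S) mv

    infix 4 _⊆ᴳ_

    _⊆ᴳ_ : Guess → Guess → Set
    S ⊆ᴳ S′ = ∀ i {j : Fin m} → j ∈ᶜ S i → j ∈ᶜ S′ i

    -- The guess found for the tail of a run grows when an earlier step is added, and the tail must
    -- remain a walk.
    walk-mono : ∀ {S S′ l x y} → S ⊆ᴳ S′ →
                Walks.Walk (Enabled S) l x y → Walks.Walk (Enabled S′) l x y
    walk-mono {S} {S′} S⊆S′ =
      Star.map λ { (Walks.go p<l e mv) → Walks.go p<l (enabled-mono e) mv }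
      where
      enabled-mono : ∀ {p t} → Enabled S p t → Enabled S′ p t
      enabled-mono (onWord at t∈)         = onWord at t∈
      enabled-mono (onData i (j , j∈ , eq)) = onData i (j , S⊆S′ i j∈ , eq)

    module _ (S : Guess) (i : Index α) (j : Fin m) where

      added? : ∀ i′ → U.Decidable λ j′ → j′ ∈ᶜ S i′ ⊎ (i′ ≡ i × j′ ≡ j)
      added? i′ j′ = j′ ∈ᶜ? S i′ ⊎-dec (i′ Fin.≟ i ×-dec j′ Fin.≟ j)

      add : Guess
      add i′ = code (added? i′)

      ⊆-add : S ⊆ᴳ add
      ⊆-add i′ j∈ = from (∈-code (added? i′) _) (inj₁ j∈)

      ∈-add : j ∈ᶜ add i
      ∈-add = from (∈-code (added? i) j) (inj₂ (refl , refl))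

      add-satisfied : Satisfied S → α , i ⊨ guard j → Satisfied add
      add-satisfied sat s i′ {j′} j∈ with to (∈-code (added? i′) j′) j∈
      ... | inj₁ j∈S           = sat i′ j∈S
      ... | inj₂ (refl , refl) = s

    none? : U.Decidable {A = Fin m} (λ _ → ⊥)
    none? _ = no λ ()

    -- Guess exactly the data transitions that the given run takes.
    steps⇒walk : ∀ {x y} → Star (Step A α) x y →
                 ∃[ S ] (Satisfied S × Walks.Walk (Enabled S) (suc end) x y)
    steps⇒walk ε =
      (λ _ → code none?) , (λ _ {j} j∈ → contradiction (to (∈-code none? j) j∈) λ ()) , ε
    steps⇒walk (onWord at t∈ mv ◅ ss) with S , sat , ws ← steps⇒walk ss
      = S , sat , Walks.go (enabled-bound e) e mv ◅ ws
      where e = onWord at t∈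
    steps⇒walk (onData i t∈ s mv ◅ ss) with S , sat , ws ← steps⇒walk ss
      = add S i j , add-satisfied S i j sat s′ ,
        Walks.go (enabled-bound e) e mv ◅ walk-mono (⊆-add S i j) ws
      where
      j = index t∈
      s′ = subst (λ t → α , i ⊨ proj₁ (proj₂ t)) (Any.lookup-index t∈) s
      e = onData i (j , ∈-add S i j ,
            cong (λ (q , _ , q′ , d) → q , q′ , d) (sym (Any.lookup-index t∈)))

    accepts₂⇒walk : Accepts₂ A α → ∃[ S ] (Satisfied S × AcceptingWalk S)
    accepts₂⇒walk (q , q′ , q∈I , q′∈F , ss) with S , sat , ws ← steps⇒walk ss
      = S , sat , q , q′ , q∈I , q′∈F , ws

    equivalent : Accepts₂ A α ⇔ Accepts B α
    equivalent = mk⇔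
      (λ acc → let S , sat , ws = accepts₂⇒walk acc in trace⇒accepts sat (walk⇒trace ws))
      (λ acc → let S , sat , tr = accepts⇒trace acc in walk⇒accepts₂ sat (trace⇒walk tr))

-- Size bounds

length-cartesianProduct : ∀ {X Y : Set} (xs : List X) (ys : List Y) →
  length (cartesianProduct xs ys) ≡ length xs * length ys
length-cartesianProduct []       ys = refl
length-cartesianProduct (x ∷ xs) ys = trans (length-++ (map (x ,_) ys))
  (cong₂ _+_ (length-map (x ,_) ys) (length-cartesianProduct xs ys))

module _ {X : Set} (f : X → ℕ) where

  sum-map-≤ : ∀ {b} → (∀ x → f x ≤ b) → ∀ xs → sum (map f xs) ≤ length xs * b
  sum-map-≤ f≤b []       = z≤n
  sum-map-≤ f≤b (x ∷ xs) = +-mono-≤ (f≤b x) (sum-map-≤ f≤b xs)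

  sum-map-filter : {P : X → Set} (P? : U.Decidable P) → ∀ xs →
                   sum (map f (filter P? xs)) ≤ sum (map f xs)
  sum-map-filter P? []       = z≤n
  sum-map-filter P? (x ∷ xs) with P? x
  ... | yes _ = +-monoʳ-≤ (f x) (sum-map-filter P? xs)
  ... | no  _ = ≤-trans (sum-map-filter P? xs) (m≤n+m _ (f x))

  length≤sum-map : (∀ x → 1 ≤ f x) → ∀ xs → length xs ≤ sum (map f xs)
  length≤sum-map 1≤f []       = z≤n
  length≤sum-map 1≤f (x ∷ xs) = +-mono-≤ (1≤f x) (length≤sum-map 1≤f xs)

  map-lookup : ∀ xs → map (f ∘ lookup xs) (allFin (length xs)) ≡ map f xs
  map-lookup xs = trans (map-tabulate (λ j → j) (f ∘ lookup xs))
    (trans (sym (map-tabulate (lookup xs) f)) (cong (map f) (tabulate-lookup xs)))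

-- The 3 is the size of the final `cur ∼ cur`, and each conjunct brings one `∧`.
∥conj∥ : ∀ {σ} (cs : List (Constraint σ)) →
         ∥ conj cs ∥c ≡ 3 + sum (map (λ c → 1 + ∥ c ∥c) cs)
∥conj∥ []       = refl
∥conj∥ (c ∷ cs) rewrite ∥conj∥ cs = lemma ∥ c ∥c _
  where
  lemma : ∀ a b → 1 + a + (3 + b) ≡ 3 + (1 + a + b)
  lemma = solve-∀

open ≤-Reasoning

n<2^n : ∀ n → suc n ≤ 2 ^ n
n<2^n zero    = s≤s z≤n
n<2^n (suc n) = begin
  2 + n         ≤⟨ s≤s (m≤n+m (suc n) n) ⟩
  suc n + suc n ≤⟨ +-mono-≤ (n<2^n n) (n<2^n n) ⟩
  2 ^ n + 2 ^ n ≡⟨ cong (2 ^ n +_) (sym (+-identityʳ _)) ⟩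
  2 ^ suc n     ∎

n≤n*n : ∀ n → n ≤ n * n
n≤n*n zero    = z≤n
n≤n*n (suc n) = m≤m*n (suc n) (suc n)

-- To be read with `x` states of either sort, `l` letters, `m` guesses and `c` the weight of a data
-- transition. The total is at most `8 * X ^ 4`, whose exponent `3 + 4 * (N * N + N)` is quadratic
-- in `N`.
exponential : ∀ N {x l m c} (let X = 2 ^ (N * N + N)) →
  x ≤ X → l ≤ X → m ≤ X → c ≤ 4 * X →
  x + x + x * (l * x) + x * (m * x) * c ≤ 2 ^ (8 * N ^ 2 + 8)
exponential N {x} {l} {m} {c} x≤ l≤ m≤ c≤ = begin
  x + x + x * (l * x) + x * (m * x) * c
    ≤⟨ +-mono-≤ (+-mono-≤ (+-mono-≤ x≤ x≤) (*-mono-≤ x≤ (*-mono-≤ l≤ x≤)))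
        (*-mono-≤ (*-mono-≤ x≤ (*-mono-≤ m≤ x≤)) c≤) ⟩
  X + X + X * (X * X) + X * (X * X) * (4 * X)
    ≤⟨ +-monoˡ-≤ _ (+-mono-≤ (+-mono-≤ X≤X⁴ X≤X⁴) (m≤n*m (X * (X * X)) X {{m^n≢0 2 e}})) ⟩
  X * (X * (X * X)) + X * (X * (X * X)) + X * (X * (X * X)) + X * (X * X) * (4 * X)
    -- The sum amounts to seven fourth powers of `X`; an eighth makes the factor a power of 2.
    ≤⟨ m≤m+n _ (X * (X * (X * X))) ⟩
  X * (X * (X * X)) + X * (X * (X * X)) + X * (X * (X * X)) + X * (X * X) * (4 * X)
    + X * (X * (X * X))
    ≡⟨ regroup X ⟩
  8 * (X * (X * (X * X)))
    ≡⟨ cong (8 *_) (sym powers) ⟩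
  2 ^ 3 * 2 ^ (e + (e + (e + e)))
    ≡⟨ ^-distribˡ-+-* 2 3 (e + (e + (e + e))) ⟨
  2 ^ (3 + (e + (e + (e + e))))
    ≤⟨ ^-monoʳ-≤ 2 exponent ⟩
  2 ^ (8 * N ^ 2 + 8) ∎
  where
  e X : ℕ
  e = N * N + N
  X = 2 ^ e

  X≤X⁴ : X ≤ X * (X * (X * X))
  X≤X⁴ = m≤m*n X (X * (X * X))
    {{m*n≢0 X (X * X) {{m^n≢0 2 e}} {{m*n≢0 X X {{m^n≢0 2 e}} {{m^n≢0 2 e}}}}}}

  regroup : ∀ X → X * (X * (X * X)) + X * (X * (X * X)) + X * (X * (X * X))
                    + X * (X * X) * (4 * X) + X * (X * (X * X)) ≡ 8 * (X * (X * (X * X)))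
  regroup = solve-∀

  powers : 2 ^ (e + (e + (e + e))) ≡ X * (X * (X * X))
  powers = trans (^-distribˡ-+-* 2 e _) (cong (X *_)
    (trans (^-distribˡ-+-* 2 e _) (cong (X *_) (^-distribˡ-+-* 2 e e))))

  lemma : ∀ a b → 3 + ((a + b) + ((a + b) + ((a + b) + (a + b)))) ≡ 4 * a + 4 * b + 3
  lemma = solve-∀

  lemma′ : ∀ N → 4 * (N * N) + 4 * (N * N) + 8 ≡ 8 * (N * (N * 1)) + 8
  lemma′ = solve-∀

  exponent : 3 + (e + (e + (e + e))) ≤ 8 * N ^ 2 + 8
  exponent = begin
    3 + (e + (e + (e + e)))         ≡⟨ lemma (N * N) N ⟩
    4 * (N * N) + 4 * N + 3
      ≤⟨ +-mono-≤ (+-monoʳ-≤ (4 * (N * N)) (*-monoʳ-≤ 4 (n≤n*n N))) (m≤m+n 3 5) ⟩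
    4 * (N * N) + 4 * (N * N) + 8   ≡⟨ lemma′ N ⟩
    8 * N ^ 2 + 8                   ∎

module _ {σ : ℕ} (A : 2NRRA σ) where
  open Construction A
  open 2NRRA A

  cost : Q × Constraint σ × Q × Dir → ℕ
  cost (_ , c , _) = 1 + ∥ c ∥c

  costs : ℕ
  costs = sum (map cost δd)

  -- Each place of `δd` contributes at most once, so no guess costs more than all the constraints of
  -- `A` together.
  ∥guards∥ : ∀ S → ∥ guards S ∥c ≤ 3 + costs
  ∥guards∥ S = begin
    ∥ guards S ∥c
      ≡⟨ ∥conj∥ (map guard js) ⟩
    3 + sum (map (λ c → 1 + ∥ c ∥c) (map guard js))
      ≡⟨ cong (λ z → 3 + sum z) (sym (map-∘ js)) ⟩
    3 + sum (map (cost ∘ lookup δd) js)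
      ≤⟨ +-monoʳ-≤ 3 (sum-map-filter (cost ∘ lookup δd) (_∈ᶜ? S) (allFin m)) ⟩
    3 + sum (map (cost ∘ lookup δd) (allFin m))
      ≡⟨ cong (λ z → 3 + sum z) (map-lookup cost δd) ⟩
    3 + costs ∎
    where js = filter (_∈ᶜ? S) (allFin m)

  length-triples : ∀ {X : Set} (xs : List X) → length (triples xs) ≡ M * (length xs * M)
  length-triples xs = trans (length-cartesianProduct (allFin M) _)
    (cong₂ _*_ (length-tabulate {n = M} (λ i → i)) (trans (length-cartesianProduct xs _)
      (cong (length xs *_) (length-tabulate {n = M} (λ i → i)))))

  -- In `4 + costs`, 3 is for the truth constraint closing the conjunction and 1 for the transition
  -- itself.
  size-B : size B ≤ M + M + M * (length δw * M) + M * (2 ^ m * M) * (4 + costs)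
  size-B = +-mono-≤ (+-monoʳ-≤ (M + M) words) datums
    where
    words : length (NRRA.δw B) ≤ M * (length δw * M)
    words = begin
      length (NRRA.δw B)              ≤⟨ length-filter word? (triples readLetters) ⟩
      length (triples readLetters)    ≡⟨ length-triples readLetters ⟩
      M * (length readLetters * M)    ≤⟨ *-monoʳ-≤ M (*-monoˡ-≤ M (length-mapMaybe _ δw)) ⟩
      M * (length δw * M)             ∎

    guesses = triples (allFin (2 ^ m))

    weight : Fin M × Constraint σ × Fin M → ℕ
    weight (_ , c , _) = 1 + ∥ c ∥c

    datums : sum (map weight (NRRA.δd B)) ≤ M * (2 ^ m * M) * (4 + costs)
    datums = begin
      sum (map weight (NRRA.δd B))
        ≡⟨ cong sum (sym (map-∘ (filter datum? guesses))) ⟩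
      sum (map (weight ∘ guarded) (filter datum? guesses))
        ≤⟨ sum-map-≤ (weight ∘ guarded) (λ (_ , S , _) → s≤s (∥guards∥ S))
             (filter datum? guesses) ⟩
      length (filter datum? guesses) * (4 + costs)
        ≤⟨ *-monoˡ-≤ (4 + costs) (length-filter datum? guesses) ⟩
      length guesses * (4 + costs)
        ≡⟨ cong (_* (4 + costs)) (trans (length-triples (allFin (2 ^ m)))
             (cong (λ z → M * (z * M)) (length-tabulate {n = 2 ^ m} (λ i → i)))) ⟩
      M * (2 ^ m * M) * (4 + costs) ∎

  size-bound : size B ≤ 2 ^ (8 * size₂ A ^ 2 + 8)
  size-bound = ≤-trans size-B (exponential N M≤ (≤-trans l≤N N≤X) 2^m≤ costs≤)
    where
    N X : ℕ
    N = size₂ A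
    X = 2 ^ (N * N + N)

    N<X : suc N ≤ X
    N<X = ≤-trans (n<2^n N) (^-monoʳ-≤ 2 (m≤n+m N (N * N)))

    N≤X : N ≤ X
    N≤X = <⇒≤ N<X

    l≤N : length δw ≤ N
    l≤N = ≤-trans (m≤n+m _ s) (m≤m+n _ costs)

    s≤N : s ≤ N
    s≤N = ≤-trans (m≤m+n s (length δw)) (m≤m+n _ costs)

    costs≤N : costs ≤ N
    costs≤N = m≤n+m costs _

    M≤ : M ≤ X
    M≤ = begin
      2 ^ (s * s) * s
        ≤⟨ *-mono-≤ (^-monoʳ-≤ 2 (*-mono-≤ s≤N s≤N)) (≤-trans s≤N (<⇒≤ (n<2^n N))) ⟩
      2 ^ (N * N) * 2 ^ N ≡⟨ ^-distribˡ-+-* 2 (N * N) N ⟨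
      X                   ∎

    2^m≤ : 2 ^ m ≤ X
    -- Every data transition costs at least 1, hence `m` is at most `costs`.
    2^m≤ = ^-monoʳ-≤ 2 (≤-trans (length≤sum-map cost (λ _ → s≤s z≤n) δd)
      (≤-trans costs≤N (m≤n+m N (N * N))))

    costs≤ : 4 + costs ≤ 4 * X
    costs≤ = begin
      4 + costs ≤⟨ +-monoʳ-≤ 4 (≤-trans costs≤N (m≤n*m N 4)) ⟩
      4 + 4 * N ≡⟨ *-suc 4 N ⟨
      4 * suc N ≤⟨ *-monoʳ-≤ 4 N<X ⟩
      4 * X     ∎

proposition8 : ∃[ a ] ∃[ k ]
    ((σ : ℕ) (D : Set) → Infinite D → (A : 2NRRA σ) →
    ∃[ B ] (((α : DataPath σ D) → Accepts₂ A α ⇔ Accepts B α) ×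
    size B ≤ 2 ^ (a * size₂ A ^ k + a)))
proposition8 = 8 , 2 , λ σ D _ A →
  Construction.B A , Construction.equivalent A , size-bound A
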